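{- For every integer $n\geq 12$, there is a $3$-dicritical oriented graph with $n$ vertices and $\left\lceil \frac{5}{2}n\right\rceil$ arcs. In other words, $o_3(n) \leq \left\lceil \frac{5}{2}n \right\rceil$ for every $n \geq 12$.
   Context: Digraphs are finite, have no loops and no parallel arcs; two opposite arcs are allowed. An oriented graph is a digraph with no pair of opposite arcs. A subdigraph $D'$ of $D$ satisfies $V(D')\subseteq V(D)$, $A(D')\subseteq A(D)$; it is proper if $V(D')\neq V(D)$ or $A(D')\neq A(D)$. A $k$-dicolouring of a digraph is a colouring of its vertices with colours in $\{1,\dots,k\}$ such that each colour class induces an acyclic subdigraph. The dichromatic number $\vec{\chi}(D)$ is the least $k$ such that $D$ has a $k$-dicolouring. $D$ is $k$-dicritical if $\vec{\chi}(D)=k$ and $\vec{\chi}(D')<k$ for every proper subdigraph $D'$ of $D$. $o_k(n)$ denotes the minimum number of arcs of a $k$-dicritical oriented graph on $n$ vertices, with $o_k(n)=+\infty$ if there is none. -}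

module Defs where

open import Data.Empty using (⊥; ⊥-elim)
open import Data.Fin.Base using (Fin; zero; suc; toℕ; fromℕ<)
open import Data.Fin.Properties as Fin using (any?; all?; toℕ-fromℕ<; toℕ<n; toℕ-injective; injective⇒≤)
open import Data.Fin.Subset using (Subset; _∈_; _⊆_; ∣_∣)
open import Data.Fin.Subset.Properties using (_∈?_; anySubset?; _⊆?_; ∣p∣≤n)
open import Data.List.Base as List using (List; []; _∷_; _∷ʳ_; length)
open import Data.List.Membership.Propositional.Properties using (∈-lookup)
open import Data.List.Relation.Unary.All as All using ()
open import Data.List.Relation.Unary.AllPairs using (_∷_)
open import Data.List.Relation.Unary.Linked as Linked using (Linked; linked?; _∷_)
open import Data.List.Relation.Unary.Unique.Propositional using (Unique)
import Data.List.Relation.Unary.Unique.DecPropositional as DecUnique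
open import Data.Nat.Base using (ℕ; zero; suc; _≤_; _<_; _*_; z≤n; s≤s)
open import Data.Nat.Properties as ℕ using (_≤?_; ≤-antisym)
open import Data.Product.Base using (∃; ∃-syntax; _×_; _,_; proj₁; proj₂)
open import Data.Sum.Base using (_⊎_; inj₁; inj₂)
open import Data.Vec.Base as Vec using (Vec; []; _∷_; lookup; tabulate)
open import Data.Vec.Properties as Vecₚ using ([]=⇒lookup; lookup⇒[]=; lookup∘tabulate)
open import Data.Bool.Properties as Bool using ()
open import Function.Base using (_∘_)
open import Relation.Binary.PropositionalEquality using (_≡_; _≢_; refl; sym; trans; cong; subst)
open import Relation.Nullary using (¬_; Dec; yes; no; does)
open import Relation.Nullary.Decidable using (map′; _×-dec_; _⊎-dec_; _→-dec_; ¬?; dec-true)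
open import Relation.Nullary.Construct.Add.Supremum using (_⁺; ⊤⁺; [_])
open import Relation.Binary.Construct.Add.Supremum.NonStrict _≤_ using (_≤⁺_; [_]; _≤⊤⁺) public
open import Relation.Unary using (Decidable)

private variable
  N : ℕ

------------------------------------------------------------------------
-- Digraphs

-- The vertices are drawn from the ambient set Fin N, so that a subdigraph of
-- a digraph is again a digraph over the same ambient set.  Row u of A is the
-- out-neighbourhood of u; parallel arcs are thereby excluded.
record Digraph (N : ℕ) : Set where
  field
    V : Subset N
    A : Vec (Subset N) N

  Arc : Fin N → Fin N → Set
  Arc u v = v ∈ lookup A u

  field
    loopless : ∀ v → ¬ Arc v v
    ends     : ∀ u v → Arc u v → u ∈ V × v ∈ V

open Digraph

order : Digraph N → ℕ
order D = ∣ V D ∣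

arcCount : Digraph N → ℕ
arcCount D = Vec.sum (Vec.map ∣_∣ (A D))

Oriented : Digraph N → Set
Oriented D = ∀ u v → Arc D u v → ¬ Arc D v u

record Subdigraph (D′ D : Digraph N) : Set where
  field
    V⊆   : V D′ ⊆ V D
    Arc⊆ : ∀ u v → Arc D′ u v → Arc D u v

record ProperSubdigraph (D′ D : Digraph N) : Set where
  field
    subdigraph : Subdigraph D′ D
    proper     : V D′ ≢ V D ⊎ A D′ ≢ A D

⟪_⟫ : {P : Fin N → Set} → Decidable P → Subset N
⟪ P? ⟫ = tabulate (λ v → does (P? v))

∈⟪⟫⁺ : {P : Fin N → Set} (P? : Decidable P) → ∀ {v} → P v → v ∈ ⟪ P? ⟫
∈⟪⟫⁺ P? {v} p = lookup⇒[]= v _ (trans (lookup∘tabulate _ v) (dec-true (P? v) p))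

∈⟪⟫⁻ : {P : Fin N → Set} (P? : Decidable P) → ∀ {v} → v ∈ ⟪ P? ⟫ → P v
∈⟪⟫⁻ P? {v} v∈ with P? v | trans (sym (lookup∘tabulate (λ w → does (P? w)) v)) ([]=⇒lookup v∈)
... | yes p | _  = p
... | no _  | ()

module _ (D : Digraph N) (X : Subset N) where

  InducedArc : Fin N → Fin N → Set
  InducedArc u v = Arc D u v × u ∈ X × v ∈ X

  inducedVertex? : Decidable (λ v → v ∈ V D × v ∈ X)
  inducedVertex? v = (v ∈? V D) ×-dec (v ∈? X)

  inducedArc? : ∀ u → Decidable (InducedArc u)
  inducedArc? u v = (v ∈? lookup (A D) u) ×-dec (u ∈? X) ×-dec (v ∈? X)

  inducedA : Vec (Subset N) N
  inducedA = tabulate (λ u → ⟪ inducedArc? u ⟫)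

  inducedA⁻ : ∀ u v → v ∈ lookup inducedA u → InducedArc u v
  inducedA⁻ u v a =
    ∈⟪⟫⁻ (inducedArc? u) (subst (v ∈_) (lookup∘tabulate (λ w → ⟪ inducedArc? w ⟫) u) a)

  inducedA⁺ : ∀ u v → InducedArc u v → v ∈ lookup inducedA u
  inducedA⁺ u v a =
    subst (v ∈_) (sym (lookup∘tabulate (λ w → ⟪ inducedArc? w ⟫) u)) (∈⟪⟫⁺ (inducedArc? u) a)

  induced : Digraph N
  induced .V = ⟪ inducedVertex? ⟫
  induced .A = inducedA
  induced .loopless v a = loopless D v (proj₁ (inducedA⁻ v v a))
  induced .ends u v a with inducedA⁻ u v a
  ... | uv , u∈X , v∈X with ends D u v uv
  ...   | u∈V , v∈V = ∈⟪⟫⁺ inducedVertex? (u∈V , u∈X) , ∈⟪⟫⁺ inducedVertex? (v∈V , v∈X)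

-- The list v₀ ∷ v₁ ∷ … ∷ vₗ stands for the cycle v₀ → v₁ → … → vₗ → v₀.
IsDirectedCycle : Digraph N → List (Fin N) → Set
IsDirectedCycle D []       = ⊥
IsDirectedCycle D (v ∷ vs) = Unique (v ∷ vs) × Linked (Arc D) ((v ∷ vs) ∷ʳ v)

Acyclic : Digraph N → Set
Acyclic D = ∀ vs → ¬ IsDirectedCycle D vs

------------------------------------------------------------------------
-- Dicolourings

colourClass : Digraph N → (Fin N → ℕ) → ℕ → Subset N
colourClass D c i = ⟪ (λ v → (v ∈? V D) ×-dec (c v ℕ.≟ i)) ⟫

-- Values of c outside V D are irrelevant.
record IsDicolouring (D : Digraph N) (k : ℕ) (c : Fin N → ℕ) : Set where
  field
    colours : ∀ v → v ∈ V D → 1 ≤ c v × c v ≤ k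
    acyclic : ∀ i → Acyclic (induced D (colourClass D c i))

open IsDicolouring

Dicolourable : Digraph N → ℕ → Set
Dicolourable D k = ∃ (IsDicolouring D k)

IsDichromaticNumber : Digraph N → ℕ → Set
IsDichromaticNumber D k = Dicolourable D k × (∀ j → Dicolourable D j → k ≤ j)

least : {P : ℕ → Set} → Decidable P → ∀ n → P n → ∃[ m ] P m × (∀ j → P j → m ≤ j)
least P? zero p = zero , p , λ _ _ → z≤n
least P? (suc n) p with P? 0
... | yes p₀ = zero , p₀ , λ _ _ → z≤n
... | no ¬p₀ with least (P? ∘ suc) n p
...   | m , pm , min = suc m , pm , λ where
          zero    q → ⊥-elim (¬p₀ q)
          (suc j) q → s≤s (min j q)

lookup-inj : (xs : List (Fin N)) → Unique xs → ∀ {i j} → List.lookup xs i ≡ List.lookup xs j → i ≡ j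
lookup-inj (x ∷ xs) (h ∷ u) {zero}  {zero}  e = refl
lookup-inj (x ∷ xs) (h ∷ u) {zero}  {suc j} e = ⊥-elim (All.lookup h (∈-lookup j) e)
lookup-inj (x ∷ xs) (h ∷ u) {suc i} {zero}  e = ⊥-elim (All.lookup h (∈-lookup i) (sym e))
lookup-inj (x ∷ xs) (h ∷ u) {suc i} {suc j} e = cong suc (lookup-inj xs u e)

anyList? : {P : List (Fin N) → Set} → Decidable P → ∀ b → Dec (∃[ xs ] length xs ≤ b × P xs)
anyList? P? zero = map′ (λ p → [] , z≤n , p) (λ where ([] , _ , p) → p) (P? [])
anyList? P? (suc b) = map′
  (λ where (inj₁ p) → [] , z≤n , p
           (inj₂ (x , xs , l , p)) → x ∷ xs , s≤s l , p)
  (λ where ([] , _ , p) → inj₁ p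
           (x ∷ xs , s≤s l , p) → inj₂ (x , xs , l , p))
  (P? [] ⊎-dec any? (λ x → anyList? (P? ∘ (x ∷_)) b))

arc? : (D : Digraph N) → ∀ u v → Dec (Arc D u v)
arc? D u v = v ∈? lookup (A D) u

cycle? : (D : Digraph N) → Decidable (IsDirectedCycle D)
cycle? D []       = no λ ()
cycle? D (v ∷ vs) = DecUnique.unique? Fin._≟_ (v ∷ vs) ×-dec linked? (arc? D) ((v ∷ vs) ∷ʳ v)

cycle-short : (D : Digraph N) → ∀ vs → IsDirectedCycle D vs → length vs ≤ N
cycle-short D (v ∷ vs) (u , _) = injective⇒≤ (lookup-inj (v ∷ vs) u)

acyclic? : (D : Digraph N) → Dec (Acyclic D)
acyclic? {N} D = map′
  (λ ¬c vs c → ¬c (vs , cycle-short D vs c , c))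
  (λ where ac (vs , _ , c) → ac vs c)
  (¬? (anyList? (cycle? D) N))

firstArc : (D : Digraph N) → ∀ v vs → IsDirectedCycle D (v ∷ vs) → ∃ (Arc D v)
firstArc D v []      (_ , a ∷ _) = _ , a
firstArc D v (_ ∷ _) (_ , a ∷ _) = _ , a

cycle-map : (D D′ : Digraph N) → (∀ u v → Arc D u v → Arc D′ u v) →
            ∀ vs → IsDirectedCycle D vs → IsDirectedCycle D′ vs
cycle-map D D′ f (v ∷ vs) (u , l) = u , Linked.map (f _ _) l

module _ (D : Digraph N) where

  class⁺ : ∀ c i {v} → v ∈ V D × c v ≡ i → v ∈ colourClass D c i
  class⁺ c i = ∈⟪⟫⁺ (λ v → (v ∈? V D) ×-dec (c v ℕ.≟ i))

  class⁻ : ∀ c i {v} → v ∈ colourClass D c i → v ∈ V D × c v ≡ i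
  class⁻ c i = ∈⟪⟫⁻ (λ v → (v ∈? V D) ×-dec (c v ℕ.≟ i))

  recolour : ∀ {k} c c′ → (∀ v → v ∈ V D → c v ≡ c′ v) → IsDicolouring D k c → IsDicolouring D k c′
  recolour c c′ e h .colours v v∈ = subst (λ x → 1 ≤ x × x ≤ _) (e v v∈) (h .colours v v∈)
  recolour c c′ e h .acyclic i vs cyc = h .acyclic i vs (cycle-map (induced D (colourClass D c′ i)) (induced D (colourClass D c i)) f vs cyc)
    where
    g : ∀ {v} → v ∈ colourClass D c′ i → v ∈ colourClass D c i
    g v∈ with class⁻ c′ i v∈
    ... | v∈V , eq = class⁺ c i (v∈V , trans (e _ v∈V) eq)

    f : ∀ u v → Arc (induced D (colourClass D c′ i)) u v → Arc (induced D (colourClass D c i)) u v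
    f u v a with inducedA⁻ D (colourClass D c′ i) u v a
    ... | a′ , u∈ , v∈ = inducedA⁺ D (colourClass D c i) u v (a′ , g u∈ , g v∈)

  isDicolouring? : ∀ k c → Dec (IsDicolouring D k c)
  isDicolouring? k c = map′ to from
    (all? (λ v → (v ∈? V D) →-dec ((1 ≤? c v) ×-dec (c v ≤? k)))
      ×-dec all? (λ v → acyclic? (induced D (colourClass D c (c v)))))
    where
    to : (∀ v → v ∈ V D → 1 ≤ c v × c v ≤ k) × (∀ v → Acyclic (induced D (colourClass D c (c v)))) →
         IsDicolouring D k c
    to (r , ac) .colours = r
    to (r , ac) .acyclic i (v ∷ vs) cyc with firstArc (induced D (colourClass D c i)) v vs cyc
    ... | w , a with class⁻ c i (proj₁ (proj₂ (inducedA⁻ D (colourClass D c i) v w a)))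
    ...   | _ , refl = ac v (v ∷ vs) cyc

    from : IsDicolouring D k c →
           (∀ v → v ∈ V D → 1 ≤ c v × c v ≤ k) × (∀ v → Acyclic (induced D (colourClass D c (c v))))
    from h = h .colours , λ v → h .acyclic (c v)

anyVec? : {X : Set} → ({P : X → Set} → Decidable P → Dec (∃ P)) →
          ∀ n {P : Vec X n → Set} → Decidable P → Dec (∃ P)
anyVec? s zero    P? = map′ (λ p → [] , p) (λ where ([] , p) → p) (P? [])
anyVec? s (suc n) P? = map′
  (λ where (x , xs , p) → x ∷ xs , p)
  (λ where (x ∷ xs , p) → x , xs , p)
  (s (λ x → anyVec? s n (λ xs → P? (x ∷ xs))))

dicolourable? : (D : Digraph N) → Decidable (Dicolourable D)
dicolourable? {N} D k = map′
  (λ where (c , h) → toℕ ∘ lookup c , h)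
  (λ where (c , h) → tabulate (cap c) , recolour D c _ (agree c h) h)
  (anyVec? {X = Fin (suc k)} any? N (λ c → isDicolouring? D k (toℕ ∘ lookup c)))
  where
  cap : (Fin N → ℕ) → Fin N → Fin (suc k)
  cap c v = fromℕ< (s≤s (ℕ.m⊓n≤n (c v) k))

  agree : ∀ c → IsDicolouring D k c → ∀ v → v ∈ V D → c v ≡ toℕ (lookup (tabulate (cap c)) v)
  agree c h v v∈ = sym (trans (cong toℕ (lookup∘tabulate (cap c) v))
    (trans (toℕ-fromℕ< (s≤s (ℕ.m⊓n≤n (c v) k))) (ℕ.m≤n⇒m⊓n≡m (proj₂ (h .colours v v∈)))))

rainbow : (D : Digraph N) → Dicolourable D N
rainbow D = c , record { colours = λ v _ → s≤s z≤n , toℕ<n v ; acyclic = ac }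
  where
  c : Fin _ → ℕ
  c v = suc (toℕ v)

  ac : ∀ i → Acyclic (induced D (colourClass D c i))
  ac i (v ∷ vs) cyc with firstArc (induced D (colourClass D c i)) v vs cyc
  ... | w , a with inducedA⁻ D (colourClass D c i) v w a
  ...   | vw , v∈ , w∈ with toℕ-injective (ℕ.suc-injective
                              (trans (proj₂ (class⁻ D c i v∈)) (sym (proj₂ (class⁻ D c i w∈)))))
  ...     | refl = loopless D v vw

abstract
  dichromaticNumber : (D : Digraph N) → ∃ (IsDichromaticNumber D)
  dichromaticNumber {N} D = least (dicolourable? D) N (rainbow D)

χ⃗ : Digraph N → ℕ
χ⃗ D = proj₁ (dichromaticNumber D)

χ⃗-isDichromaticNumber : (D : Digraph N) → IsDichromaticNumber D (χ⃗ D)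
χ⃗-isDichromaticNumber D = proj₂ (dichromaticNumber D)

record Dicritical (k : ℕ) (D : Digraph N) : Set where
  field
    χ⃗≡k        : χ⃗ D ≡ k
    subdigraphs : ∀ D′ → ProperSubdigraph D′ D → χ⃗ D′ < k

------------------------------------------------------------------------
-- The minimum number of arcs

-- Up to isomorphism, a digraph on n vertices has vertex set Fin n.
HasDicriticalOriented : (k n m : ℕ) → Set
HasDicriticalOriented k n m =
  ∃[ D ] Oriented {n} D × Dicritical k D × order D ≡ n × arcCount D ≡ m

-- ℕ ⁺ is ℕ with a greatest element ⊤⁺, playing the role of +∞.
data IsMinimum (P : ℕ → Set) : ℕ ⁺ → Set where
  attained : ∀ {m} → P m → (∀ j → P j → m ≤ j) → IsMinimum P [ m ]
  none     : (∀ j → ¬ P j) → IsMinimum P ⊤⁺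

private

  subdigraph? : (D′ D : Digraph N) → Dec (Subdigraph D′ D)
  subdigraph? D′ D = map′ to from
    ((V D′ ⊆? V D) ×-dec all? (λ u → all? (λ v → arc? D′ u v →-dec arc? D u v)))
    where
    Raw : Set
    Raw = V D′ ⊆ V D × (∀ u v → Arc D′ u v → Arc D u v)

    to : Raw → Subdigraph D′ D
    to (v , a) = record { V⊆ = v ; Arc⊆ = a }

    from : Subdigraph D′ D → Raw
    from s = Subdigraph.V⊆ s , Subdigraph.Arc⊆ s

  proper? : (D′ D : Digraph N) → Dec (ProperSubdigraph D′ D)
  proper? D′ D = map′
    (λ where (s , p) → record { subdigraph = s ; proper = p })
    (λ s → ProperSubdigraph.subdigraph s , ProperSubdigraph.proper s)
    (subdigraph? D′ D ×-dec
      (¬? (Vecₚ.≡-dec Bool._≟_ (V D′) (V D)) ⊎-dec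
       ¬? (Vecₚ.≡-dec (Vecₚ.≡-dec Bool._≟_) (A D′) (A D))))

  Valid : Subset N → Vec (Subset N) N → Set
  Valid V A = (∀ v → ¬ v ∈ lookup A v) × (∀ u v → v ∈ lookup A u → u ∈ V × v ∈ V)

  valid? : (V : Subset N) (A : Vec (Subset N) N) → Dec (Valid V A)
  valid? V A = all? (λ v → ¬? (v ∈? lookup A v)) ×-dec
    all? (λ u → all? (λ v → (v ∈? lookup A u) →-dec ((u ∈? V) ×-dec (v ∈? V))))

  mk : (V : Subset N) (A : Vec (Subset N) N) → Valid V A → Digraph N
  mk V A h = record { V = V ; A = A ; loopless = proj₁ h ; ends = proj₂ h }

  Respects : (Digraph N → Set) → Set
  Respects {N} P = ∀ V A (h h′ : Valid {N} V A) → P (mk V A h) → P (mk V A h′)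

  anyDigraph? : {P : Digraph N → Set} → Respects P → Decidable P → Dec (∃ P)
  anyDigraph? {N} {P} resp P? = map′ to from (anySubset? (λ V → anyVec? anySubset? N (valid×? V)))
    where
    Raw : Subset N → Vec (Subset N) N → Set
    Raw V A = ∃ λ (h : Valid V A) → P (mk V A h)

    valid×? : ∀ V A → Dec (Raw V A)
    valid×? V A with valid? V A
    ... | no ¬h = no (¬h ∘ proj₁)
    ... | yes h = map′ (h ,_) (λ (h′ , p) → resp V A h′ h p) (P? (mk V A h))

    to : (∃ λ V → ∃ (Raw V)) → ∃ P
    to (V , A , h , p) = mk V A h , p

    from : ∃ P → ∃ λ V → ∃ (Raw V)
    from (D , p) = V D , A D , (loopless D , ends D) , p

  dicolourable-mk : ∀ V A {k} (h h′ : Valid {N} V A) →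
                    Dicolourable (mk V A h) k → Dicolourable (mk V A h′) k
  dicolourable-mk V A h h′ (c , d) = c , record { colours = d .colours ; acyclic = ac }
    where
    D  = mk V A h
    D′ = mk V A h′

    ac : ∀ i → Acyclic (induced D′ (colourClass D′ c i))
    ac i vs cyc = d .acyclic i vs
      (cycle-map (induced D′ (colourClass D′ c i)) (induced D (colourClass D c i)) (λ _ _ a → a) vs cyc)

  χ⃗-mk : ∀ V A (h h′ : Valid {N} V A) → χ⃗ (mk V A h) ≡ χ⃗ (mk V A h′)
  χ⃗-mk V A h h′ with χ⃗-isDichromaticNumber (mk V A h) | χ⃗-isDichromaticNumber (mk V A h′)
  ... | d , l | d′ , l′ =
    ≤-antisym (l _ (dicolourable-mk V A h′ h d′)) (l′ _ (dicolourable-mk V A h h′ d))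

  castProper₁ : ∀ V A {D : Digraph N} (h h′ : Valid V A) →
                ProperSubdigraph (mk V A h) D → ProperSubdigraph (mk V A h′) D
  castProper₁ V A h h′ s = record
    { subdigraph = record { V⊆ = Subdigraph.V⊆ t ; Arc⊆ = Subdigraph.Arc⊆ t }
    ; proper = ProperSubdigraph.proper s }
    where t = ProperSubdigraph.subdigraph s

  castProper₂ : ∀ V A {D : Digraph N} (h h′ : Valid V A) →
                ProperSubdigraph D (mk V A h) → ProperSubdigraph D (mk V A h′)
  castProper₂ V A h h′ s = record
    { subdigraph = record { V⊆ = Subdigraph.V⊆ t ; Arc⊆ = Subdigraph.Arc⊆ t }
    ; proper = ProperSubdigraph.proper s }
    where t = ProperSubdigraph.subdigraph s

  dicritical? : ∀ k (D : Digraph N) → Dec (Dicritical k D)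
  dicritical? k D = map′
    (λ where (e , ¬bad) → record
               { χ⃗≡k = e
               ; subdigraphs = λ D′ s → ℕ.≰⇒> (λ k≤ → ¬bad (D′ , s , k≤)) })
    (λ c → Dicritical.χ⃗≡k c ,
           λ where (D′ , s , k≤) → ℕ.<⇒≱ (Dicritical.subdigraphs c D′ s) k≤)
    ((χ⃗ D ℕ.≟ k) ×-dec ¬? (anyDigraph? resp (λ D′ → proper? D′ D ×-dec (k ≤? χ⃗ D′))))
    where
    resp : Respects (λ D′ → ProperSubdigraph D′ D × k ≤ χ⃗ D′)
    resp V A h h′ (s , k≤) = castProper₁ V A h h′ s , subst (k ≤_) (χ⃗-mk V A h h′) k≤

  hasDicriticalOriented? : ∀ k n → Decidable (HasDicriticalOriented k n)
  hasDicriticalOriented? k n m = anyDigraph? resp λ D →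
    all? (λ u → all? (λ v → arc? D u v →-dec ¬? (arc? D v u))) ×-dec
    dicritical? k D ×-dec (order D ℕ.≟ n) ×-dec (arcCount D ℕ.≟ m)
    where
    resp : Respects (λ D → Oriented D × Dicritical k D × order D ≡ n × arcCount D ≡ m)
    resp V A h h′ (o , c , e , f) = o , record
      { χ⃗≡k = trans (sym (χ⃗-mk V A h h′)) (Dicritical.χ⃗≡k c)
      ; subdigraphs = λ D′ s → Dicritical.subdigraphs c D′ (castProper₂ V A h′ h s) } , e , f

  sum-bound : ∀ {b l} (xs : Vec ℕ l) → (∀ i → lookup xs i ≤ b) → Vec.sum xs ≤ l * b
  sum-bound []       h = z≤n
  sum-bound (x ∷ xs) h = ℕ.+-mono-≤ (h zero) (sum-bound xs (h ∘ suc))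

  arcCount≤ : (D : Digraph N) → arcCount D ≤ N * N
  arcCount≤ D = sum-bound (Vec.map ∣_∣ (A D)) λ i →
    subst (_≤ _) (sym (Vecₚ.lookup-map i ∣_∣ (A D))) (∣p∣≤n (lookup (A D) i))

abstract
  minimumArcs : ∀ k n → ∃ (IsMinimum (HasDicriticalOriented k n))
  minimumArcs k n with any? {n = suc (n * n)} (λ m → hasDicriticalOriented? k n (toℕ m))
  ... | yes (m , p) with least (hasDicriticalOriented? k n) (toℕ m) p
  ...   | m′ , p′ , min = [ m′ ] , attained p′ min
  minimumArcs k n | no ¬p = ⊤⁺ , none λ where
    j (D , o , c , e , refl) → ¬p (fromℕ< (s≤s (arcCount≤ D)) ,
      subst (HasDicriticalOriented k n) (sym (toℕ-fromℕ< (s≤s (arcCount≤ D)))) (D , o , c , e , refl))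

o : ℕ → ℕ → ℕ ⁺
o k n = proj₁ (minimumArcs k n)

o-isMinimum : ∀ k n → IsMinimum (HasDicriticalOriented k n) (o k n)
o-isMinimum k n = proj₂ (minimumArcs k n)

{-# OPTIONS --safe #-}
module Submission where

-- The 3-dicritical digraphs below are grown by one operation on a digraph G
-- (digons allowed) with a digon p ⇄ q: delete the arc q ⟶ p, add a new directed
-- circuit C on k vertices, and add all arcs from q to C and from C to p.  The
-- result G′ has k more vertices and 3k - 1 more arcs.  The operation preserves
-- 3-dicriticality (Critical-replaceDigon):
--
-- * Suppose that G′ has a 2-dicolouring.  If p and q differ in colour, it
--   restricts to a 2-dicolouring of G.  If they agree, every triangle
--   p ⟶ q ⟶ i ⟶ p with i in C forces the vertex i to the other colour, so that
--   C is monochromatic.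
--
-- * Let e be an arc of G′, and let f = e when e is an arc of G and f = q ⟶ p
--   otherwise.  A 2-dicolouring of G - f extends to one of G′ - e.  If p and q
--   differ, give one vertex of C the colour of p and the others the colour of q
--   (split).  If they agree and e is an arc of C, give all of C the other colour
--   (otherColour).  If they agree and e is p ⟶ q or joins C to p or q, give one
--   vertex of C, an end of e in the last case, their common colour and the rest
--   the other one (single).
--
-- Start with the bidirected triangle, which has 3 vertices and 6 arcs, and
-- replace two of its digons with k = 3: this gives K₉, with 9 vertices, 22 arcs
-- and one digon.  A replacement with k = 2 creates a new digon on C, so it can be
-- iterated; each such step adds 2 vertices and 5 arcs.  A last replacement
-- with k = 3 or k = 4 removes the remaining digon.  After j intermediate steps,
-- this yields oriented graphs with 12 + 2j vertices and 30 + 5j arcs, and with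
-- 13 + 2j vertices and 33 + 5j arcs.
--
-- Acyclicity of the colour classes is certified by a rank function that
-- increases along every monochromatic arc; the absence of a 2-dicolouring is
-- certified by a monochromatic directed cycle for every 2-colouring.

open import Defs
open import Data.Nat.Base using (ℕ; _≤_; _*_; ⌈_/2⌉)
open import Data.Product.Base using (_×_; ∃-syntax)
open import Relation.Binary.PropositionalEquality using (_≡_)
open import Relation.Nullary.Construct.Add.Supremum using ([_])

open import Data.Bool.Base using (Bool; true; false; if_then_else_; not; _∧_; _∨_)
open import Data.Bool.Properties as Bool using (not-¬)
open import Data.Empty using (⊥; ⊥-elim)
open import Data.Fin.Base using (Fin; zero; suc; toℕ; splitAt; _↑ˡ_)
open import Data.Fin.Properties as Fin using (any?; all?; +↔⊎; splitAt⁻¹-↑ˡ)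
open import Data.Fin.Subset using (∣_∣; _∈_; ⊤)
open import Data.Fin.Subset.Properties using (∈⊤; ⊆-antisym; ∣⊤∣≡n)
open import Data.List.Base as List using (List; []; _∷_; _∷ʳ_; allFin)
import Data.List.Properties as List
open import Data.List.Relation.Unary.All using ([]; _∷_)
open import Data.List.Relation.Unary.AllPairs using ([]; _∷_)
open import Data.List.Relation.Unary.Linked as Linked using (Linked; [-]; _∷_; linked?)
import Data.List.Relation.Unary.Linked.Properties as Linked
open import Data.List.Relation.Unary.Unique.Propositional using (Unique)
import Data.List.Relation.Unary.Unique.Propositional.Properties as Unique
import Data.List.Relation.Unary.Unique.DecPropositional as DecUnique
open import Data.Nat.Base using (zero; suc; _+_; _∸_; _%_; _<_; z≤n; s≤s; z<s)
open import Data.Nat.DivMod using (_mod_)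
open import Data.Nat.Properties as ℕ using ()
open import Data.Nat.Solver using (module +-*-Solver)
open +-*-Solver using (solve; con; _:+_; _:*_; _:=_)
open import Data.Product.Base using (Σ; ∃; ∃₂; _,_; proj₁; proj₂)
open import Data.Product.Properties using (,-injectiveˡ; ,-injectiveʳ; ≡-dec)
open import Data.Sum.Algebra using (⊎-comm)
open import Data.Sum.Base using (_⊎_; inj₁; inj₂; [_,_]′)
open import Data.Sum.Properties using (inj₁-injective; inj₂-injective)
open import Data.Vec.Base as Vec using (tabulate; lookup)
open import Data.Vec.Properties using ([]=⇒lookup; lookup⇒[]=; lookup∘tabulate; tabulate-∘; tabulate∘lookup; tabulate-cong)
open import Function.Base using (_∘_; _$_)
open import Function.Bundles using (_↔_; Inverse)
open import Function.Construct.Composition using (_↔-∘_)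
open import Relation.Binary.PropositionalEquality using (_≢_; refl; sym; trans; cong; cong₂; subst; subst₂)
open import Relation.Nullary using (¬_; Dec; yes; no; does)
open import Relation.Nullary.Decidable using (dec-true; from-yes; decidable-stable; True; toWitness; _×-dec_; _→-dec_; _⊎-dec_; ¬?)

private variable
  V W : Set
  k m n : ℕ

------------------------------------------------------------------------
-- Critical adjacency relations

-- A digraph on the vertex set V, as a Boolean adjacency relation.  Digons are
-- allowed; loops are not excluded here.
Adj : Set → Set
Adj V = V → V → Bool

_[_⟶_] : Adj V → V → V → Set
E [ u ⟶ v ] = E u v ≡ true

-- As in IsDirectedCycle, the list v ∷ vs stands for the cycle that returns from
-- its last vertex to v.
Cycle : (V → V → Set) → List V → Set
Cycle R []       = ⊥
Cycle R (v ∷ vs) = Unique (v ∷ vs) × Linked R ((v ∷ vs) ∷ʳ v)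

Cycle-map : {R : V → V → Set} {S : W → W → Set} (f : V → W) →
            (∀ {u v} → f u ≡ f v → u ≡ v) → (∀ {u v} → R u v → S (f u) (f v)) →
            ∀ vs → Cycle R vs → Cycle S (List.map f vs)
Cycle-map {S = S} f f-inj h (v ∷ vs) (u , l) =
  Unique.map⁺ f-inj u ,
  subst (Linked S) (List.map-++ f (v ∷ vs) List.[ v ]) (Linked.map⁺ (Linked.map h l))

-- The monochromatic arcs.  A cycle of this relation is a monochromatic cycle.
Mono : Adj V → (V → Bool) → V → V → Set
Mono E c u v = E [ u ⟶ v ] × c u ≡ c v

-- The rank r increases along every monochromatic arc other than e, so that c is a
-- 2-dicolouring of the digraph without e.
RankedBut : Adj V → V × V → (V → Bool) → (V → ℕ) → Set
RankedBut E e c r = ∀ a b → E [ a ⟶ b ] → (a , b) ≢ e → c a ≡ c b → r a < r b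

-- A digraph without 2-dicolouring that loses this property with any of its arcs.
-- This is 3-dicriticality with respect to arc deletion; deletion of an isolated
-- vertex is dealt with separately, through HasOut.
record Critical (E : Adj V) : Set where
  field
    mono-cycle : ∀ c → ∃ (Cycle (Mono E c))
    cut        : ∀ {u v} → E [ u ⟶ v ] → ∃₂ (RankedBut E (u , v))

-- The digraph on W that the bijection f turns into E.
relabel : (f : W ↔ V) → Adj V → Adj W
relabel f E a b = E (Inverse.to f a) (Inverse.to f b)

Critical-relabel : (f : W ↔ V) {E : Adj V} → Critical E → Critical (relabel f E)
Critical-relabel f {E} K = record
  { mono-cycle = λ c → let vs , cyc = mono-cycle (c ∘ from) in
      List.map from vs , Cycle-map from from-inj
        (λ (a , e) → subst₂ (E [_⟶_]) (sym (to∘from _)) (sym (to∘from _)) a , e) vs cyc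
  ; cut = λ a → let c , r , h = cut a in c ∘ to , r ∘ to , λ x y xy ≠e → h (to x) (to y) xy
      λ eq → ≠e (cong₂ _,_ (to-inj (,-injectiveˡ eq)) (to-inj (,-injectiveʳ eq)))
  }
  where
  open Critical K
  open Inverse f using (to; from)
  to∘from : ∀ x → to (from x) ≡ x
  to∘from = Inverse.strictlyInverseˡ f
  from-inj : ∀ {x y} → from x ≡ from y → x ≡ y
  from-inj e = trans (sym (to∘from _)) (trans (cong to e) (to∘from _))
  to-inj : ∀ {x y} → to x ≡ to y → x ≡ y
  to-inj e = trans (sym (Inverse.strictlyInverseʳ f _)) (trans (cong from e) (Inverse.strictlyInverseʳ f _))

-- The abstract properties of a directed circuit that the replacement needs: H has
-- a cycle, H without any one arc is acyclic (as certified by a rank), every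
-- vertex has an out-neighbour, and there are no loops.
record MinimalCyclic (H : Adj (Fin k)) : Set where
  field
    cycle    : ∃ (Cycle (H [_⟶_]))
    cutRank  : ∀ {i j} → H [ i ⟶ j ] →
               Σ (Fin k → ℕ) λ ρ → ∀ a b → H [ a ⟶ b ] → (a , b) ≢ (i , j) → ρ a < ρ b
    next     : Fin k → Fin k
    out      : ∀ i → H [ i ⟶ next i ]
    loopless : ∀ i → H i i ≡ false

≢⇒not : ∀ {x y} → x ≢ y → not x ≡ y
≢⇒not {true}  {true}  h = ⊥-elim (h refl)
≢⇒not {true}  {false} h = refl
≢⇒not {false} {true}  h = refl
≢⇒not {false} {false} h = ⊥-elim (h refl)

-- The digraph obtained from E, with a digon p ⇄ q, by deleting q ⟶ p and adding
-- H together with all arcs from q to H and from H to p.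
replaceDigon : Adj (Fin k) → Adj (Fin n) → (p q : Fin n) → Adj (Fin k ⊎ Fin n)
replaceDigon H E p q (inj₁ i) (inj₁ j) = H i j
replaceDigon H E p q (inj₁ i) (inj₂ v) = does (v Fin.≟ p)
replaceDigon H E p q (inj₂ u) (inj₁ j) = does (u Fin.≟ q)
replaceDigon H E p q (inj₂ u) (inj₂ v) = if does (u Fin.≟ q) ∧ does (v Fin.≟ p) then false else E u v

does-≡ : (i j : Fin n) → does (i Fin.≟ j) ≡ true → i ≡ j
does-≡ i j e with i Fin.≟ j
... | yes p = p

-- The arcs between old vertices are those of E except q ⟶ p.
module _ {H : Adj (Fin k)} {E : Adj (Fin n)} {p q : Fin n} where

  replaceDigon-old⁻ : ∀ {u v} → replaceDigon H E p q [ inj₂ u ⟶ inj₂ v ] → E [ u ⟶ v ] × (u , v) ≢ (q , p)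
  replaceDigon-old⁻ {u} {v} a with u Fin.≟ q | v Fin.≟ p
  ... | no u≢q | _      = a , u≢q ∘ ,-injectiveˡ
  ... | yes _  | no v≢p = a , v≢p ∘ ,-injectiveʳ

  replaceDigon-old⁺ : ∀ {u v} → E [ u ⟶ v ] → (u , v) ≢ (q , p) → replaceDigon H E p q [ inj₂ u ⟶ inj₂ v ]
  replaceDigon-old⁺ {u} {v} a ≠e with u Fin.≟ q | v Fin.≟ p
  ... | no _     | _        = a
  ... | yes _    | no _     = a
  ... | yes refl | yes refl = ⊥-elim (≠e refl)

module _ {H : Adj (Fin (suc k))} (minimal : MinimalCyclic H) {E : Adj (Fin n)} (K : Critical E)
         {p q : Fin n} (p≢q : p ≢ q) (pq : E [ p ⟶ q ]) (qp : E [ q ⟶ p ]) where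

  open MinimalCyclic minimal
  open Critical K

  private

    X = Fin (suc k) ⊎ Fin n

    E′ : Adj X
    E′ = replaceDigon H E p q

    old⁻ : ∀ {u v} → E′ [ inj₂ u ⟶ inj₂ v ] → E [ u ⟶ v ] × (u , v) ≢ (q , p)
    old⁻ = replaceDigon-old⁻ {H = H} {E}

    old⁺ : ∀ {u v} → E [ u ⟶ v ] → (u , v) ≢ (q , p) → E′ [ inj₂ u ⟶ inj₂ v ]
    old⁺ = replaceDigon-old⁺ {H = H} {E}

    q⟶ : ∀ i → E′ [ inj₂ q ⟶ inj₁ i ]
    q⟶ i = dec-true (q Fin.≟ q) refl

    ⟶p : ∀ i → E′ [ inj₁ i ⟶ inj₂ p ]
    ⟶p i = dec-true (p Fin.≟ p) refl

    p⟶q : E′ [ inj₂ p ⟶ inj₂ q ]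
    p⟶q = old⁺ pq (p≢q ∘ ,-injectiveˡ)

    -- If p and q agree and no new vertex has their colour, then all of H has the other
    -- colour.
    mono′ : ∀ c → ∃ (Cycle (Mono E′ c))
    mono′ c with c (inj₂ p) Bool.≟ c (inj₂ q)
    ... | no cp≢cq = let vs , cyc = mono-cycle (c ∘ inj₂) in
      List.map inj₂ vs , Cycle-map inj₂ inj₂-injective
        (λ where (a , e) → old⁺ a (λ where refl → cp≢cq (sym e)) , e) vs cyc
    ... | yes cp≡cq with any? (λ i → c (inj₁ i) Bool.≟ c (inj₂ p))
    ...   | yes (i , i≡p) = inj₂ p ∷ inj₂ q ∷ inj₁ i ∷ [] ,
        ((p≢q ∘ inj₂-injective) ∷ (λ ()) ∷ []) ∷ ((λ ()) ∷ []) ∷ [] ∷ [] ,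
        (p⟶q , cp≡cq) ∷ (q⟶ i , trans (sym cp≡cq) (sym i≡p)) ∷ (⟶p i , i≡p) ∷ [-]
    ...   | no ¬any = let vs , cyc = cycle in
        List.map inj₁ vs , Cycle-map inj₁ inj₁-injective (λ {i} {j} a → a , trans (sym (other i)) (other j)) vs cyc
      where
      other : ∀ i → not (c (inj₂ p)) ≡ c (inj₁ i)
      other i = ≢⇒not (λ e → ¬any (i , sym e))

    -- The part of RankedBut that concerns the old vertices.  The extension lemmas
    -- take it as a hypothesis, for an arbitrary removed arc e of the new digraph.
    OldRanked : X × X → (Fin n → Bool) → (Fin n → ℕ) → Set
    OldRanked e c r = ∀ a b → E′ [ inj₂ a ⟶ inj₂ b ] → (inj₂ a , inj₂ b) ≢ e → c a ≡ c b → r a < r b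

    module _ {e : X × X} {c : Fin n → Bool} where

      -- The new vertex w takes the colour of p and has no monochromatic in-arc; the
      -- others take the colour of q and have no monochromatic arc to old vertices.  So w
      -- is ranked lowest and the others above q.
      split : ∀ {r} → OldRanked e c r → c p ≢ c q → ∃₂ (RankedBut E′ e)
      split {r} old cp≢cq = c′ , r′ , ranked
        where
        w : Fin (suc k)
        w = zero

        ρ : Fin (suc k) → ℕ
        ρ = proj₁ (cutRank (out w))

        c′ : X → Bool
        c′ (inj₁ i) = if does (i Fin.≟ w) then c p else c q
        c′ (inj₂ v) = c v

        r′ : X → ℕ
        r′ (inj₁ i) = if does (i Fin.≟ w) then 0 else 2 + r q + ρ i
        r′ (inj₂ v) = suc (r v)

        ranked : RankedBut E′ e c′ r′
        ranked (inj₁ i) (inj₁ j) a ≠e m with i Fin.≟ w | j Fin.≟ w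
        ... | yes refl | yes refl with trans (sym a) (loopless w)
        ...   | ()
        ranked (inj₁ i) (inj₁ j) a ≠e m | yes _  | no _  = ⊥-elim (cp≢cq m)
        ranked (inj₁ i) (inj₁ j) a ≠e m | no _   | yes _ = ⊥-elim (cp≢cq (sym m))
        ranked (inj₁ i) (inj₁ j) a ≠e m | no i≢w | no _  =
          ℕ.+-monoʳ-< (2 + r q) (proj₂ (cutRank (out w)) i j a (i≢w ∘ ,-injectiveˡ))
        ranked (inj₁ i) (inj₂ v) a ≠e m with does-≡ v p a | i Fin.≟ w
        ... | _    | yes _ = z<s
        ... | refl | no _  = ⊥-elim (cp≢cq (sym m))
        ranked (inj₂ u) (inj₁ j) a ≠e m with does-≡ u q a | j Fin.≟ w
        ... | refl | yes _ = ⊥-elim (cp≢cq (sym m))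
        ... | refl | no _  = s≤s (s≤s (ℕ.m≤m+n (r q) (ρ j)))
        ranked (inj₂ u) (inj₂ v) a ≠e m = s≤s (old u v a ≠e m)

      -- The new vertex w takes the common colour of p and q, the others the opposite
      -- one.  The only monochromatic arcs between old and new vertices are q ⟶ w and
      -- w ⟶ p, so w needs a rank s between those of q and p, unless e is one of them.
      single : ∀ {r} → OldRanked e c r → c p ≡ c q → ∀ w s →
               ((inj₂ q , inj₁ w) ≢ e → r q < s) → ((inj₁ w , inj₂ p) ≢ e → s < r p) →
               ∃₂ (RankedBut E′ e)
      single {r} old cp≡cq w s q<s s<p = c′ , r′ , ranked
        where
        ρ : Fin (suc k) → ℕ
        ρ = proj₁ (cutRank (out w))

        c′ : X → Bool
        c′ (inj₁ i) = if does (i Fin.≟ w) then c p else not (c p)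
        c′ (inj₂ v) = c v

        r′ : X → ℕ
        r′ (inj₁ i) = if does (i Fin.≟ w) then s else ρ i
        r′ (inj₂ v) = r v

        ranked : RankedBut E′ e c′ r′
        ranked (inj₁ i) (inj₁ j) a ≠e m with i Fin.≟ w | j Fin.≟ w
        ... | yes refl | yes refl with trans (sym a) (loopless w)
        ...   | ()
        ranked (inj₁ i) (inj₁ j) a ≠e m | yes _  | no _  = ⊥-elim (not-¬ refl m)
        ranked (inj₁ i) (inj₁ j) a ≠e m | no _   | yes _ = ⊥-elim (not-¬ refl (sym m))
        ranked (inj₁ i) (inj₁ j) a ≠e m | no i≢w | no _  =
          proj₂ (cutRank (out w)) i j a (i≢w ∘ ,-injectiveˡ)
        ranked (inj₁ i) (inj₂ v) a ≠e m with does-≡ v p a | i Fin.≟ w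
        ... | refl | yes refl = s<p ≠e
        ... | refl | no _     = ⊥-elim (not-¬ refl (sym m))
        ranked (inj₂ u) (inj₁ j) a ≠e m with does-≡ u q a | j Fin.≟ w
        ... | refl | yes refl = q<s ≠e
        ... | refl | no _     = ⊥-elim (not-¬ refl (trans cp≡cq m))
        ranked (inj₂ u) (inj₂ v) a ≠e m = old u v a ≠e m

      -- All new vertices avoid the common colour of p and q, so that no arc between old
      -- and new vertices is monochromatic.
      otherColour : ∀ {r} → OldRanked e c r → c p ≡ c q → ∀ {ρ : Fin (suc k) → ℕ} →
                    (∀ i j → H [ i ⟶ j ] → (inj₁ i , inj₁ j) ≢ e → ρ i < ρ j) → ∃₂ (RankedBut E′ e)
      otherColour {r} old cp≡cq {ρ} hρ = c′ , r′ , ranked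
        where
        c′ : X → Bool
        c′ (inj₁ i) = not (c p)
        c′ (inj₂ v) = c v

        r′ : X → ℕ
        r′ (inj₁ i) = ρ i
        r′ (inj₂ v) = r v

        ranked : RankedBut E′ e c′ r′
        ranked (inj₁ i) (inj₁ j) a ≠e m = hρ i j a ≠e
        ranked (inj₁ i) (inj₂ v) a ≠e m with does-≡ v p a
        ... | refl = ⊥-elim (not-¬ refl (sym m))
        ranked (inj₂ u) (inj₁ j) a ≠e m with does-≡ u q a
        ... | refl = ⊥-elim (not-¬ refl (trans cp≡cq m))
        ranked (inj₂ u) (inj₂ v) a ≠e m = old u v a ≠e m

    -- A dicolouring of E without q ⟶ p serves for every arc e.
    withoutQP : ∀ e → OldRanked e (proj₁ (cut qp)) (proj₁ (proj₂ (cut qp)))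
    withoutQP e a b ab _ = let ab′ , ≠e = old⁻ ab in proj₂ (proj₂ (cut qp)) a b ab′ ≠e

    cut′ : ∀ {x y} → E′ [ x ⟶ y ] → ∃₂ (RankedBut E′ (x , y))
    cut′ {inj₁ i} {inj₁ j} ij with cut qp | withoutQP (inj₁ i , inj₁ j)
    ... | c , r , _ | old with c p Bool.≟ c q
    ...   | no cp≢cq = split old cp≢cq
    ...   | yes cp≡cq = otherColour old cp≡cq
            (λ a b ab ≠e → proj₂ (cutRank ij) a b ab (λ where refl → ≠e refl))
    cut′ {inj₁ i} {inj₂ v} a with does-≡ v p a | cut qp | withoutQP (inj₁ i , inj₂ v)
    ... | refl | c , r , _ | old with c p Bool.≟ c q
    ...   | no cp≢cq = split old cp≢cq
    ...   | yes cp≡cq = single old cp≡cq i (suc (r q)) (λ _ → ℕ.n<1+n _) (λ ≠e → ⊥-elim (≠e refl))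
    cut′ {inj₂ u} {inj₁ j} a with does-≡ u q a | cut qp | withoutQP (inj₂ u , inj₁ j)
    ... | refl | c , r , _ | old with c p Bool.≟ c q
    ...   | no cp≢cq = split old cp≢cq
    -- The ranks are shifted so that 0 lies below all of them.
    ...   | yes cp≡cq = single {r = suc ∘ r} (λ a b ab ≠e m → s≤s (old a b ab ≠e m)) cp≡cq j 0
                        (λ ≠e → ⊥-elim (≠e refl)) (λ _ → z<s)
    cut′ {inj₂ u} {inj₂ v} a with old⁻ a
    ... | uv , _ with cut uv
    ...   | c , r , h with c p Bool.≟ c q
    ...     | no cp≢cq = split (λ a b ab ≠e m → h a b (proj₁ (old⁻ ab)) (λ where refl → ≠e refl) m) cp≢cq
    -- As p and q agree and r q < r p, the removed arc is p ⟶ q.  Doubling the ranks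
    -- makes room for a rank between those of q and p.
    ...     | yes cp≡cq = single {r = λ v → 2 * r v}
                (λ a b ab ≠e m → ℕ.*-monoʳ-< 2 (h a b (proj₁ (old⁻ ab)) (λ where refl → ≠e refl) m))
                cp≡cq zero (suc (2 * r q)) (λ _ → ℕ.n<1+n _)
                (λ _ → subst (_≤ 2 * r p) (ℕ.*-suc 2 (r q)) (ℕ.*-monoʳ-≤ 2 q<p))
      where
      q<p : r q < r p
      q<p = h q p qp (λ where refl → proj₂ (old⁻ a) refl) (sym cp≡cq)

  Critical-replaceDigon : Critical (replaceDigon H E p q)
  Critical-replaceDigon = record { mono-cycle = mono′ ; cut = cut′ }

------------------------------------------------------------------------
-- Directed circuits

-- The cyclic successor.
succ : Fin (suc k) → Fin (suc k)
succ {k} i = suc (toℕ i) mod suc k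

-- The directed circuit on suc k vertices.
circuit : ∀ k → Adj (Fin (suc k))
circuit k i j = does (succ i Fin.≟ j)

-- The number of arcs on the path along the circuit from succ i to a.  It is 0 at
-- succ i and k at i, and increases along every arc but i ⟶ succ i.
distanceFromSucc : Fin (suc k) → Fin (suc k) → ℕ
distanceFromSucc {k} i a = (toℕ a + (k ∸ toℕ i)) % suc k

-- The hypotheses are decided by evaluation for a numeral k.
circuit-minimal : ∀ k →
  True (linked? (λ i j → circuit k i j Bool.≟ true) (allFin (suc k) ∷ʳ zero)) →
  True (DecUnique.unique? Fin._≟_ (allFin (suc k))) →
  True (all? {n = suc k} λ i → all? λ a → ¬? (a Fin.≟ i) →-dec (distanceFromSucc i a ℕ.<? distanceFromSucc i (succ a))) →
  True (all? λ i → circuit k i i Bool.≟ false) →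
  MinimalCyclic (circuit k)
circuit-minimal k l u d ll = record
  { cycle    = allFin (suc k) , toWitness u , toWitness l
  ; cutRank  = λ {i} ij → distanceFromSucc i , λ a b ab ≠ij →
      subst (λ b → distanceFromSucc i a < distanceFromSucc i b) (does-≡ (succ a) b ab)
        (toWitness d i a λ where refl → ≠ij (cong (i ,_) (trans (sym (does-≡ (succ i) _ ab)) (does-≡ (succ i) _ ij))))
  ; next     = succ
  ; out      = λ i → dec-true (succ i Fin.≟ succ i) refl
  ; loopless = toWitness ll
  }

circuit₂ : MinimalCyclic (circuit 1)
circuit₂ = circuit-minimal 1 _ _ _ _

circuit₃ : MinimalCyclic (circuit 2)
circuit₃ = circuit-minimal 2 _ _ _ _

circuit₄ : MinimalCyclic (circuit 3)
circuit₄ = circuit-minimal 3 _ _ _ _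

------------------------------------------------------------------------
-- The base digraph

-- The bidirected triangle.
K₃ : Adj (Fin 3)
K₃ i j = not (does (i Fin.≟ j))

K₃-critical : Critical K₃
K₃-critical = record { mono-cycle = mono ; cut = λ {u} {v} uv → colour u v , rank u v , ranked u v uv }
  where
  digon : ∀ {c} u v → u ≢ v → K₃ [ u ⟶ v ] → K₃ [ v ⟶ u ] → c u ≡ c v → ∃ (Cycle (Mono K₃ c))
  digon u v u≢v uv vu e = u ∷ v ∷ [] , (u≢v ∷ []) ∷ [] ∷ [] , (uv , e) ∷ (vu , sym e) ∷ [-]

  mono : ∀ c → ∃ (Cycle (Mono K₃ c))
  -- Two of the three vertices share a colour.
  mono c with c zero Bool.≟ c (suc zero) | c zero Bool.≟ c (suc (suc zero))
  ... | yes e | _     = digon zero (suc zero) (λ ()) refl refl e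
  ... | no _  | yes e = digon zero (suc (suc zero)) (λ ()) refl refl e
  ... | no h  | no h′ = digon (suc zero) (suc (suc zero)) (λ ()) refl refl
                          (trans (sym (≢⇒not h)) (≢⇒not h′))

  -- Once u ⟶ v is deleted, u and v may share a colour: the only monochromatic arc
  -- that remains is v ⟶ u.
  colour : (u v x : Fin 3) → Bool
  colour u v x = does (x Fin.≟ u) ∨ does (x Fin.≟ v)

  rank : (u v x : Fin 3) → ℕ
  rank u v x = if does (x Fin.≟ v) then 0 else 1

  ranked : ∀ u v → K₃ [ u ⟶ v ] → RankedBut K₃ (u , v) (colour u v) (rank u v)
  ranked = from-yes (all? λ u → all? λ v → (K₃ u v Bool.≟ true) →-dec
    all? λ a → all? λ b → (K₃ a b Bool.≟ true) →-dec
      (¬? (≡-dec Fin._≟_ Fin._≟_ (a , b) (u , v)) →-dec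
        ((colour u v a Bool.≟ colour u v b) →-dec (rank u v a ℕ.<? rank u v b))))

-- The replacement of a digon on Fin n by a circuit on suc k new vertices, which come
-- after the old ones.  The old vertices keep their numbers.
append : ∀ k → Adj (Fin n) → (p q : Fin n) → Adj (Fin (n + suc k))
append k E p q = relabel (⊎-comm _ _ ↔-∘ +↔⊎) (replaceDigon (circuit k) E p q)

-- The replacement of the digon 0 ⇄ 1 with the new vertices coming first.  If suc k is
-- 2, the new digon is again 0 ⇄ 1.
prepend : ∀ k → Adj (Fin (2 + n)) → Adj (Fin (suc k + (2 + n)))
prepend k E = relabel (+↔⊎ {suc k}) (replaceDigon (circuit k) E zero (suc zero))

-- The digons 1 ⇄ 2 and 0 ⇄ 2 of the bidirected triangle are replaced in turn by
-- circuits on three vertices; K₉ retains the digon 0 ⇄ 1.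
K₆ : Adj (Fin 6)
K₆ = append 2 K₃ (suc zero) (suc (suc zero))

K₉ : Adj (Fin 9)
K₉ = append 2 K₆ zero (suc (suc zero))

K₉-critical : Critical K₉
K₉-critical = Critical-relabel (⊎-comm _ _ ↔-∘ +↔⊎)
  (Critical-replaceDigon circuit₃
    (Critical-relabel (⊎-comm _ _ ↔-∘ +↔⊎) (Critical-replaceDigon circuit₃ K₃-critical (λ ()) refl refl))
    (λ ()) refl refl)

------------------------------------------------------------------------
-- Iterated replacement

-- The number of arcs, counted by rows as in arcCount.
arcs : Adj (Fin n) → ℕ
arcs E = Vec.sum (tabulate λ u → ∣ tabulate (E u) ∣)

-- Every vertex has an out-neighbour.  In particular, no vertex is isolated.
HasOut : Adj V → Set
HasOut E = ∀ v → ∃ λ w → E [ v ⟶ w ]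

-- All digons of E, and all loops, are among p ⇄ q; for p ≢ q, E is thus loopless.
SoleDigon : Adj V → V → V → Set
SoleDigon E p q = ∀ u v → E [ u ⟶ v ] → E [ v ⟶ u ] → (u ≡ p × v ≡ q) ⊎ (u ≡ q × v ≡ p)

-- A critical digraph on 2 + n vertices with m arcs and with the single digon 0 ⇄ 1.
record DigonSeed (n m : ℕ) : Set where
  field
    E        : Adj (Fin (2 + n))
    critical : Critical E
    0⟶1      : E [ zero ⟶ suc zero ]
    1⟶0      : E [ suc zero ⟶ zero ]
    sole     : SoleDigon E zero (suc zero)
    hasOut   : HasOut E
    count    : arcs E ≡ m

K₉-seed : DigonSeed 7 22
K₉-seed = record
  { E = K₉ ; critical = K₉-critical ; 0⟶1 = refl ; 1⟶0 = refl
  ; sole = from-yes (all? λ u → all? λ v → (K₉ u v Bool.≟ true) →-dec ((K₉ v u Bool.≟ true) →-dec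
      (((u Fin.≟ zero) ×-dec (v Fin.≟ suc zero)) ⊎-dec ((u Fin.≟ suc zero) ×-dec (v Fin.≟ zero)))))
  ; hasOut = from-yes (all? λ u → any? λ v → K₉ u v Bool.≟ true)
  ; count = refl
  }

∣tabulate-false∣ : ∀ n → ∣ tabulate {n = n} (λ _ → false) ∣ ≡ 0
∣tabulate-false∣ zero    = refl
∣tabulate-false∣ (suc n) = ∣tabulate-false∣ n

∣true∷∣ : ∀ {b} (xs : Vec.Vec Bool n) → b ≡ true → ∣ b Vec.∷ xs ∣ ≡ suc ∣ xs ∣
∣true∷∣ xs refl = refl

-- For a literal number of new vertices, the rows of prepend reduce to those of E,
-- except that the row of vertex 1 loses the arc 1 ⟶ 0 and that new entries appear.
-- The constants below are the new entries: the arcs of the circuit and to vertex 0,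
-- which come first, and the arcs from vertex 1.
module _ (E : Adj (Fin (2 + n))) (1⟶0 : E [ suc zero ⟶ zero ]) where

  private
    a b c : ℕ
    a = ∣ tabulate (E zero) ∣
    b = ∣ tabulate (E (suc zero) ∘ suc) ∣
    c = Vec.sum (tabulate λ u → ∣ tabulate (E (suc (suc u))) ∣)

    arcs-E : arcs E ≡ a + (suc b + c)
    arcs-E = cong (λ x → a + (x + c)) (∣true∷∣ (tabulate (E (suc zero) ∘ suc)) 1⟶0)

  arcs-prepend₂ : arcs (prepend 1 E) ≡ 5 + arcs E
  arcs-prepend₂ rewrite arcs-E | ∣tabulate-false∣ n = solve 3 (λ a b c →
     con 4 :+ (a :+ (con 2 :+ b :+ c)) := con 5 :+ (a :+ (con 1 :+ b :+ c))) refl a b c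

  arcs-prepend₃ : arcs (prepend 2 E) ≡ 8 + arcs E
  arcs-prepend₃ rewrite arcs-E | ∣tabulate-false∣ n = solve 3 (λ a b c →
     con 6 :+ (a :+ (con 3 :+ b :+ c)) := con 8 :+ (a :+ (con 1 :+ b :+ c))) refl a b c

  arcs-prepend₄ : arcs (prepend 3 E) ≡ 11 + arcs E
  arcs-prepend₄ rewrite arcs-E | ∣tabulate-false∣ n = solve 3 (λ a b c →
     con 8 :+ (a :+ (con 4 :+ b :+ c)) := con 11 :+ (a :+ (con 1 :+ b :+ c))) refl a b c

module _ {H : Adj (Fin (suc k))} {E : Adj (Fin n)} {p q : Fin n} where

  HasOut-replaceDigon : HasOut E → HasOut (replaceDigon H E p q)
  HasOut-replaceDigon out (inj₁ i) = inj₂ p , dec-true (p Fin.≟ p) refl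
  HasOut-replaceDigon out (inj₂ u) with u Fin.≟ q | out u
  ... | yes refl | _      = inj₁ zero , dec-true (u Fin.≟ u) refl
  ... | no u≢q   | v , uv = inj₂ v , replaceDigon-old⁺ {H = H} {E} uv (u≢q ∘ ,-injectiveˡ)

  -- No new digon arises between old and new vertices, and p ⇄ q is gone.
  digon-replaceDigon : p ≢ q → SoleDigon E p q → ∀ {x y} →
    replaceDigon H E p q [ x ⟶ y ] → replaceDigon H E p q [ y ⟶ x ] →
    ∃₂ λ i j → x ≡ inj₁ i × y ≡ inj₁ j × H [ i ⟶ j ] × H [ j ⟶ i ]
  digon-replaceDigon p≢q sole {inj₁ i} {inj₁ j} xy yx = i , j , refl , refl , xy , yx
  digon-replaceDigon p≢q sole {inj₁ i} {inj₂ v} xy yx =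
    ⊥-elim (p≢q (trans (sym (does-≡ v p xy)) (does-≡ v q yx)))
  digon-replaceDigon p≢q sole {inj₂ u} {inj₁ j} xy yx =
    ⊥-elim (p≢q (trans (sym (does-≡ u p yx)) (does-≡ u q xy)))
  digon-replaceDigon p≢q sole {inj₂ u} {inj₂ v} xy yx
    with replaceDigon-old⁻ {H = H} {E} xy | replaceDigon-old⁻ {H = H} {E} yx
  ... | uv , uv≢qp | vu , vu≢qp with sole u v uv vu
  ...   | inj₁ (refl , refl) = ⊥-elim (vu≢qp refl)
  ...   | inj₂ (refl , refl) = ⊥-elim (uv≢qp refl)

Asymmetric : Adj V → Set
Asymmetric E = ∀ u v → E [ u ⟶ v ] → ¬ E [ v ⟶ u ]

asym? : (E : Adj (Fin n)) → Dec (Asymmetric E)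
asym? E = all? λ u → all? λ v → (E u v Bool.≟ true) →-dec ¬? (E v u Bool.≟ true)

HasOut-relabel : (f : W ↔ V) {E : Adj V} → HasOut E → HasOut (relabel f E)
HasOut-relabel f {E} out v = let w , vw = out (Inverse.to f v) in
  Inverse.from f w , subst (E [ Inverse.to f v ⟶_]) (sym (Inverse.strictlyInverseˡ f w)) vw

module _ (S : DigonSeed n m) where
  open DigonSeed S

  prepend-critical : MinimalCyclic (circuit k) → Critical (prepend k E)
  prepend-critical minimal = Critical-relabel +↔⊎ (Critical-replaceDigon minimal critical (λ ()) 0⟶1 1⟶0)

  prepend-hasOut : HasOut (prepend k E)
  prepend-hasOut {k} = HasOut-relabel (+↔⊎ {suc k}) (HasOut-replaceDigon hasOut)

  prepend-digon : ∀ {k x y} → prepend k E [ x ⟶ y ] → prepend k E [ y ⟶ x ] →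
    ∃₂ λ i j → i ↑ˡ (2 + n) ≡ x × j ↑ˡ (2 + n) ≡ y × circuit k [ i ⟶ j ] × circuit k [ j ⟶ i ]
  prepend-digon {k} {x} {y} xy yx with digon-replaceDigon {H = circuit k} (λ ()) sole {splitAt (suc k) x} {splitAt (suc k) y} xy yx
  ... | i , j , x≡ , y≡ , ij , ji = i , j , splitAt⁻¹-↑ˡ x≡ , splitAt⁻¹-↑ˡ y≡ , ij , ji

  prepend-asym : Asymmetric (circuit k) → Asymmetric (prepend k E)
  prepend-asym {k} asym x y xy yx with prepend-digon {k} {x} {y} xy yx
  ... | i , j , _ , _ , ij , ji = asym i j ij ji

  prepend-sole : SoleDigon (prepend 1 E) zero (suc zero)
  prepend-sole x y xy yx with prepend-digon {1} {x} {y} xy yx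
  ... | zero     , suc zero , refl , refl , _ = inj₁ (refl , refl)
  ... | suc zero , zero     , refl , refl , _ = inj₂ (refl , refl)
  ... | zero     , zero     , _ , _ , () , _
  ... | suc zero , suc zero , _ , _ , () , _

  nextSeed : DigonSeed (2 + n) (5 + m)
  nextSeed = record
    { E = prepend 1 E ; critical = prepend-critical circuit₂ ; 0⟶1 = refl ; 1⟶0 = refl
    ; sole = prepend-sole ; hasOut = prepend-hasOut
    ; count = trans (arcs-prepend₂ E 1⟶0) (cong (5 +_) count) }

seed : ∀ j → DigonSeed (j * 2 + 7) (j * 5 + 22)
seed zero    = K₉-seed
seed (suc j) = nextSeed (seed j)

------------------------------------------------------------------------
-- From adjacency relations to digraphs

open Digraph using (Arc)

Linked-ends : {V : Set} (r : V → ℕ) → ∀ x xs y → Linked (λ a b → r a < r b) ((x ∷ xs) ∷ʳ y) → r x < r y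
Linked-ends r x []       y (h ∷ _) = h
Linked-ends r x (z ∷ zs) y (h ∷ l) = ℕ.<-trans h (Linked-ends r z zs y l)

ranked⇒dicolouring : (D : Digraph n) (c r : Fin n → ℕ) → (∀ v → 1 ≤ c v × c v ≤ k) →
  (∀ u v → Arc D u v → c u ≡ c v → r u < r v) → IsDicolouring D k c
ranked⇒dicolouring D c r range h = record
  { colours = λ v _ → range v
  ; acyclic = λ where
      i (v ∷ vs) (_ , l) → ℕ.<-irrefl refl (Linked-ends r v vs v (Linked.map (increases i) l))
  }
  where
  increases : ∀ i {u v} → Arc (induced D (colourClass D c i)) u v → r u < r v
  increases i {u} {v} a = let uv , u∈ , v∈ = inducedA⁻ D (colourClass D c i) u v a in
    h u v uv (trans (proj₂ (class⁻ D c i u∈)) (sym (proj₂ (class⁻ D c i v∈))))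

-- All vertices of a monochromatic walk have the colour of its first vertex.
Linked-mono : ∀ {E : Adj (Fin n)} {c} x xs → Linked (Mono E c) (x ∷ xs) →
  Linked (λ a b → E [ a ⟶ b ] × c a ≡ c x × c b ≡ c x) (x ∷ xs)
Linked-mono x []       [-]           = [-]
Linked-mono {c = c} x (y ∷ ys) ((a , e) ∷ l) =
  (a , refl , sym e) ∷ Linked.map (λ (b , e₁ , e₂) → b , trans e₁ (sym e) , trans e₂ (sym e)) (Linked-mono y ys l)

module _ (E : Adj (Fin n)) (asym : Asymmetric E) where

  -- All of Fin n is the vertex set.
  toDigraph : Digraph n

  private
    row : Fin n → Vec.Vec Bool n
    row u = tabulate (E u)

    row-arc : ∀ {u v} → v ∈ lookup (tabulate row) u → E [ u ⟶ v ]
    row-arc {u} {v} v∈ = trans (sym (lookup∘tabulate (E u) v))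
      (trans (cong (λ xs → lookup xs v) (sym (lookup∘tabulate row u))) ([]=⇒lookup v∈))

  toDigraph = record
    { V = ⊤
    ; A = tabulate row
    ; loopless = λ v v∈ → asym v v (row-arc v∈) (row-arc v∈)
    ; ends = λ _ _ _ → ∈⊤ , ∈⊤
    }

  private
    D : Digraph n
    D = toDigraph

    arc⁻ : ∀ {u v} → Arc D u v → E [ u ⟶ v ]
    arc⁻ = row-arc

    arc⁺ : ∀ {u v} → E [ u ⟶ v ] → Arc D u v
    arc⁺ {u} {v} a = lookup⇒[]= v _
      (trans (cong (λ xs → lookup xs v) (lookup∘tabulate row u)) (trans (lookup∘tabulate (E u) v) a))

  toDigraph-oriented : Oriented D
  toDigraph-oriented u v uv vu = asym u v (arc⁻ uv) (arc⁻ vu)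

  toDigraph-order : order D ≡ n
  toDigraph-order = ∣⊤∣≡n n

  toDigraph-arcCount : arcCount D ≡ arcs E
  toDigraph-arcCount = cong Vec.sum (sym (tabulate-∘ ∣_∣ row))

  module _ (K : Critical E) (hasOut : HasOut E) where
    open Critical K

    private
      -- Dicolourings use the colours 1 and 2, and the relations above Booleans.
      paint : Bool → ℕ
      paint b = if b then 1 else 2

      paint-injective : ∀ {x y} → paint x ≡ paint y → x ≡ y
      paint-injective {true}  {true}  _ = refl
      paint-injective {false} {false} _ = refl

      paint-range : ∀ b → 1 ≤ paint b × paint b ≤ 2
      paint-range true  = s≤s z≤n , s≤s z≤n
      paint-range false = s≤s z≤n , s≤s (s≤s z≤n)

      is1 : ℕ → Bool
      is1 x = does (x ℕ.≟ 1)

      is1-injective : ∀ {x y} → 1 ≤ x × x ≤ 2 → 1 ≤ y × y ≤ 2 → is1 x ≡ is1 y → x ≡ y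
      is1-injective {1} {1} _ _ _ = refl
      is1-injective {2} {2} _ _ _ = refl
      is1-injective {1} {2} _ _ ()
      is1-injective {2} {1} _ _ ()
      is1-injective {suc (suc (suc _))} (_ , s≤s (s≤s ())) _ _
      is1-injective {_} {suc (suc (suc _))} _ (_ , s≤s (s≤s ())) _

      ¬2-dicolourable : ∀ {j} → Dicolourable D j → ¬ j ≤ 2
      ¬2-dicolourable {j} (c , dic) j≤2 with mono-cycle (is1 ∘ c)
      ... | v ∷ vs , u , l = IsDicolouring.acyclic dic (c v) (v ∷ vs)
              (u , Linked.map arc (Linked-mono v (vs ∷ʳ v) l))
        where
        range : ∀ w → 1 ≤ c w × c w ≤ 2
        range w = let lo , hi = IsDicolouring.colours dic w ∈⊤ in lo , ℕ.≤-trans hi j≤2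

        arc : ∀ {a b} → E [ a ⟶ b ] × is1 (c a) ≡ is1 (c v) × is1 (c b) ≡ is1 (c v) →
              Arc (induced D (colourClass D c (c v))) a b
        arc (ab , a≡ , b≡) = inducedA⁺ D (colourClass D c (c v)) _ _
          (arc⁺ ab , class⁺ D c (c v) (∈⊤ , is1-injective (range _) (range v) a≡)
                   , class⁺ D c (c v) (∈⊤ , is1-injective (range _) (range v) b≡))

      someArc : ∃₂ λ u v → E [ u ⟶ v ]
      someArc with mono-cycle (λ _ → true)
      ... | v ∷ _ , _ = v , hasOut v

      -- Delete an arc u ⟶ w, dicolour the rest with two colours and give u a third colour.
      3-dicolourable : Dicolourable D 3
      3-dicolourable with someArc
      ... | u , w , uw with cut uw
      ...   | c , r , h = c′ , ranked⇒dicolouring D c′ r range λ a b ab → ranked a b (arc⁻ ab)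
        where
        c′ : Fin n → ℕ
        c′ v = if does (v Fin.≟ u) then 3 else paint (c v)

        range : ∀ v → 1 ≤ c′ v × c′ v ≤ 3
        range v with v Fin.≟ u
        ... | yes _ = s≤s z≤n , ℕ.≤-refl
        ... | no _  = let lo , hi = paint-range (c v) in lo , ℕ.≤-trans hi (ℕ.n≤1+n 2)

        3-free : ∀ b → paint b ≢ 3
        3-free true  ()
        3-free false ()

        ranked : ∀ a b → E [ a ⟶ b ] → c′ a ≡ c′ b → r a < r b
        ranked a b ab m with a Fin.≟ u | b Fin.≟ u
        ... | yes refl | yes refl = ⊥-elim (asym a a ab ab)
        ... | yes _    | no _     = ⊥-elim (3-free (c b) (sym m))
        ... | no _     | yes _    = ⊥-elim (3-free (c a) m)
        ... | no a≢u   | no _     = h a b ab (a≢u ∘ ,-injectiveˡ) (paint-injective m)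

      dicolourable-without : ∀ {D′ u v} → Subdigraph D′ D → E [ u ⟶ v ] → ¬ Arc D′ u v → Dicolourable D′ 2
      dicolourable-without {D′} {u} {v} sub uv ¬uv with cut uv
      ... | c , r , h = paint ∘ c , ranked⇒dicolouring D′ (paint ∘ c) r (paint-range ∘ c) λ a b ab m →
              h a b (arc⁻ (Subdigraph.Arc⊆ sub a b ab)) (λ where refl → ¬uv ab) (paint-injective m)

      -- A subdigraph with all arcs also has all vertices, as each vertex has an out-arc.
      full⇒equal : ∀ {D′} → Subdigraph D′ D → (∀ u v → E [ u ⟶ v ] → Arc D′ u v) →
                   Digraph.V D′ ≡ Digraph.V D × Digraph.A D′ ≡ Digraph.A D
      full⇒equal {D′} sub full =
        ⊆-antisym (Subdigraph.V⊆ sub)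
          (λ {v} _ → let w , vw = hasOut v in proj₁ (Digraph.ends D′ v w (full v w vw))) ,
        trans (sym (tabulate∘lookup (Digraph.A D′))) (tabulate-cong λ u →
          trans (⊆-antisym (λ {v} → Subdigraph.Arc⊆ sub u v) (λ {v} uv → full u v (arc⁻ uv)))
                (lookup∘tabulate row u))

      proper-dicolourable : ∀ D′ → ProperSubdigraph D′ D → Dicolourable D′ 2
      proper-dicolourable D′ P with any? (λ u → any? λ v → (E u v Bool.≟ true) ×-dec ¬? (arc? D′ u v))
      ... | yes (u , v , uv , ¬uv) = dicolourable-without {D′} (ProperSubdigraph.subdigraph P) uv ¬uv
      ... | no ¬missing = ⊥-elim ([ _$ proj₁ D′≡D , _$ proj₂ D′≡D ]′ (ProperSubdigraph.proper P))
        where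
        D′≡D : Digraph.V D′ ≡ Digraph.V D × Digraph.A D′ ≡ Digraph.A D
        D′≡D = full⇒equal {D′} (ProperSubdigraph.subdigraph P) λ u v uv →
          decidable-stable (arc? D′ u v) (λ ¬a → ¬missing (u , v , uv , ¬a))

    toDigraph-dicritical : Dicritical 3 D
    toDigraph-dicritical = record
      { χ⃗≡k = let dic , least = χ⃗-isDichromaticNumber D in
          ℕ.≤-antisym (least 3 3-dicolourable) (ℕ.≰⇒> (¬2-dicolourable dic))
      ; subdigraphs = λ D′ P → s≤s (proj₂ (χ⃗-isDichromaticNumber D′) 2 (proper-dicolourable D′ P))
      }

------------------------------------------------------------------------
-- The two families

-- The last replacement: a circuit without digons leaves no digon at all.
digraph-from-seed : DigonSeed n m → MinimalCyclic (circuit k) → Asymmetric (circuit k) →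
  ∀ a → (∀ E → E [ suc zero ⟶ zero ] → arcs (prepend {n} k E) ≡ a + arcs E) →
  HasDicriticalOriented 3 (suc k + (2 + n)) (a + m)
digraph-from-seed {k = k} S minimal asym a arcs-prepend =
  toDigraph G G-asym ,
  toDigraph-oriented G G-asym ,
  toDigraph-dicritical G G-asym (prepend-critical S minimal) (prepend-hasOut S) ,
  toDigraph-order G G-asym ,
  trans (toDigraph-arcCount G G-asym) (trans (arcs-prepend E 1⟶0) (cong (a +_) count))
  where
  open DigonSeed S
  G = prepend k E
  G-asym = prepend-asym S asym

-- These have 12 + 2j vertices and 30 + 5j arcs.
evenFamily : ∀ j → HasDicriticalOriented 3 (5 + (j * 2 + 7)) (8 + (j * 5 + 22))
evenFamily j = digraph-from-seed (seed j) circuit₃ (from-yes (asym? (circuit 2))) 8 arcs-prepend₃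

-- These have 13 + 2j vertices and 33 + 5j arcs.
oddFamily : ∀ j → HasDicriticalOriented 3 (6 + (j * 2 + 7)) (11 + (j * 5 + 22))
oddFamily j = digraph-from-seed (seed j) circuit₄ (from-yes (asym? (circuit 3))) 11 arcs-prepend₄

⌈/2⌉-even : ∀ {x} a → x ≡ a + a → ⌈ x /2⌉ ≡ a
⌈/2⌉-even a refl = sym (ℕ.n≡⌈n+n/2⌉ a)

⌈/2⌉-odd : ∀ {x} a → x ≡ suc (a + a) → ⌈ x /2⌉ ≡ suc a
⌈/2⌉-odd a refl = cong suc (sym (ℕ.n≡⌊n+n/2⌋ a))

parity : ∀ d → ∃[ j ] (d ≡ j * 2 ⊎ d ≡ suc (j * 2))
parity zero    = 0 , inj₁ refl
parity (suc d) with parity d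
... | j , inj₁ e = j , inj₂ (cong suc e)
... | j , inj₂ e = suc j , inj₁ (cong suc e)

dicriticalOriented : ∀ n → 12 ≤ n → HasDicriticalOriented 3 n ⌈ 5 * n /2⌉
dicriticalOriented n 12≤n with parity (n ∸ 12)
... | j , inj₁ e = subst₂ (HasDicriticalOriented 3) (sym n≡) (sym arcs≡) (evenFamily j)
  where
  n≡ : n ≡ 5 + (j * 2 + 7)
  n≡ = trans (sym (ℕ.m+[n∸m]≡n 12≤n)) (trans (cong (12 +_) e)
    (solve 1 (λ j → con 12 :+ j :* con 2 := con 5 :+ (j :* con 2 :+ con 7)) refl j))

  arcs≡ : ⌈ 5 * n /2⌉ ≡ 8 + (j * 5 + 22)
  arcs≡ = ⌈/2⌉-even (8 + (j * 5 + 22)) (trans (cong (5 *_) n≡)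
    (solve 1 (λ j → let a = con 8 :+ (j :* con 5 :+ con 22) in
      con 5 :* (con 5 :+ (j :* con 2 :+ con 7)) := a :+ a) refl j))
... | j , inj₂ e = subst₂ (HasDicriticalOriented 3) (sym n≡) (sym arcs≡) (oddFamily j)
  where
  n≡ : n ≡ 6 + (j * 2 + 7)
  n≡ = trans (sym (ℕ.m+[n∸m]≡n 12≤n)) (trans (cong (12 +_) e)
    (solve 1 (λ j → con 13 :+ j :* con 2 := con 6 :+ (j :* con 2 :+ con 7)) refl j))

  arcs≡ : ⌈ 5 * n /2⌉ ≡ 11 + (j * 5 + 22)
  arcs≡ = ⌈/2⌉-odd (10 + (j * 5 + 22)) (trans (cong (5 *_) n≡)
    (solve 1 (λ j → let a = con 10 :+ (j :* con 5 :+ con 22) in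
      con 5 :* (con 6 :+ (j :* con 2 :+ con 7)) := con 1 :+ (a :+ a)) refl j))

o-≤ : HasDicriticalOriented k n m → o k n ≤⁺ [ m ]
o-≤ {k} {n} {m} w with o k n | o-isMinimum k n
... | _ | attained _ min = [ min m w ]
... | _ | none ¬w        = ⊥-elim (¬w m w)

corollary4p3 : (∀ n → 12 ≤ n → ∃[ D ] Oriented {n} D × Dicritical 3 D × order D ≡ n × arcCount D ≡ ⌈ 5 * n /2⌉)
    × (∀ n → 12 ≤ n → o 3 n ≤⁺ [ ⌈ 5 * n /2⌉ ])
corollary4p3 = dicriticalOriented , λ n 12≤n → o-≤ (dicriticalOriented n 12≤n)
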